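{- Let $H=\prod_p p^{a_p}<H'=\prod_p p^{b_p}$ be consecutive highly composite numbers with $L_-(H,H')=2$, and fix an admissible deletion order $r\mid s$ of the two required deletion layers (the layer with prime base $r$ is deleted first, the layer with prime base $s$ second). Suppose that at least one required insertion has prime base $q\ge s$ (i.e. there is a prime $q\ge s$ with $b_q>a_q$). Then $$\beta^{\mathrm{geo}}(H,H')\ge\frac12.$$ If in addition the first deletion is a support deletion $r^1\to r^0$ (i.e. it lowers the exponent of $r$ from $1$ to $0$), then $$\beta^{\mathrm{geo}}(H,H')=\frac12.$$
   Context: $d(n)$ denotes the number of positive divisors of $n$. A positive integer $H$ is highly composite if $d(m)<d(H)$ for all integers $1\le m<H$. Two highly composite numbers $H<H'$ are consecutive if no highly composite number lies strictly between them. Put $L_-(H,H')=\sum_p\max(a_p-b_p,0)$. A required deletion layer with prime base $p$ and level $j$ ($b_p<j\le a_p$) is the move lowering the exponent of $p$ from $j$ to $j-1$; a deletion order is admissible if within one prime coordinate the higher level is deleted before the lower one ($r=s$ is allowed). An exponent-lattice geodesic from $H$ to $H'$ is a sequence of positive integers starting at $H$ and ending at $H'$ in which each step changes the exponent of exactly one prime by one unit, always in the direction of its target exponent. It is $H'$-admissible if every vertex $z$ satisfies $z\le H'$. The normalised geodesic capacity is $$\beta^{\mathrm{geo}}(H,H')=\frac{1}{d(H)}\max_{\gamma}\min_{z\in\gamma}d(z),$$ where $\gamma$ ranges over the $H'$-admissible geodesics from $H$ to $H'$ and $z$ over all vertices of $\gamma$, endpoints included. -}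

module Defs where

open import Data.Integer.Base using (+_)
open import Data.List.Base using (List; []; _∷_; applyUpTo; cartesianProductWith; filter; head; last; length; map; upTo)
open import Data.List.Extrema.Nat using (max; min; argmax-sel; xs≤max)
open import Data.List.Membership.Propositional using (_∈_)
open import Data.List.Membership.Propositional.Properties using (∈-applyUpTo⁺; ∈-cartesianProductWith⁺; ∈-filter⁺; ∈-filter⁻; ∈-length; ∈-map⁺; ∈-map⁻; ∈-upTo⁺)
open import Data.List.Properties using (filter-none)
open import Data.List.Relation.Unary.All as All using (All; []; _∷_)
open import Data.List.Relation.Unary.AllPairs using (AllPairs)
open import Data.List.Relation.Unary.Any using (here; there)
open import Data.List.Relation.Unary.Linked using (Linked; []; [-]; _∷_; linked?)
open import Data.Maybe.Base using (just)
open import Data.Maybe.Properties using (≡-dec)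
open import Data.Nat hiding (_/_)
open import Data.Nat.Divisibility using (_∣_; _∣?_; ∣-refl; ∣⇒≤)
open import Data.Nat.ListAction using (sum)
open import Data.Nat.ListAction.Properties using (∈⇒∣product)
open import Data.Nat.Primality using (Prime; prime?)
open import Data.Nat.Primality.Factorisation using (PrimeFactorisation; factorise; factors)
open import Data.Nat.Properties
open import Data.Product using (_×_; _,_; ∃; ∃-syntax; proj₂)
open import Data.Rational.Base using (ℚ; _/_)
open import Data.Sum.Base using (_⊎_; inj₁; inj₂)
open import Function.Base using (id)
open import Relation.Binary.Definitions using (Decidable)
open import Relation.Binary.PropositionalEquality using (_≡_; _≢_; refl; sym; trans; cong; subst; subst₂)
open import Relation.Nullary using (¬_; Dec; yes; no; ¬?; contradiction; map′)
open import Relation.Nullary.Decidable using (_×-dec_; _⊎-dec_; _→-dec_)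

range : ℕ → List ℕ
range n = applyUpTo suc n

d : ℕ → ℕ
d n = length (filter (_∣? n) (range n))

d-nonZero : ∀ n .{{_ : NonZero n}} → NonZero (d n)
d-nonZero (suc n) =
  >-nonZero (∈-length (∈-filter⁺ (_∣? suc n) (∈-applyUpTo⁺ suc (n<1+n n)) ∣-refl))

HighlyComposite : ℕ → Set
HighlyComposite H = 1 ≤ H × (∀ m → 1 ≤ m → m < H → d m < d H)

Consecutive : ℕ → ℕ → Set
Consecutive H H' =
  HighlyComposite H × HighlyComposite H' × H < H' ×
  (∀ m → H < m → m < H' → ¬ HighlyComposite m)

-- The multiplicity of p in the prime factorisation of n; junk value 0 at n = 0.
exponent : ℕ → ℕ → ℕ
exponent p zero      = 0
exponent p n@(suc _) = length (filter (p ≟_) (factors (factorise n)))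

primesUpTo : ℕ → List ℕ
primesUpTo n = filter prime? (upTo (suc n))

-- Only primes dividing H contribute, and truncated subtraction is max(a_p - b_p, 0).
L₋ : ℕ → ℕ → ℕ
L₋ H H' = sum (map (λ p → exponent p H ∸ exponent p H') (primesUpTo H))

-- A layer is a pair (prime base , level).
Layer : Set
Layer = ℕ × ℕ

RequiredDeletion : ℕ → ℕ → Layer → Set
RequiredDeletion H H' (p , j) = Prime p × exponent p H' < j × j ≤ exponent p H

-- The list is in order of deletion.  The last condition also excludes repetitions.
record AdmissibleDeletionOrder (H H' : ℕ) (ls : List Layer) : Set where
  field
    required : All (RequiredDeletion H H') ls
    complete : ∀ l → RequiredDeletion H H' l → l ∈ ls
    descending : AllPairs (λ (p , j) (p' , j') → p ≡ p' → j' < j) ls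

RequiredInsertionBase : ℕ → ℕ → ℕ → Set
RequiredInsertionBase H H' q = Prime q × exponent q H < exponent q H'

MovesTowards : (H' p x y : ℕ) → Set
MovesTowards H' p x y =
    (exponent p x < exponent p H' × exponent p y ≡ suc (exponent p x))
  ⊎ (exponent p H' < exponent p x × exponent p x ≡ suc (exponent p y))

Step : (H' x y : ℕ) → Set
Step H' x y = ∃[ p ] Prime p × MovesTowards H' p x y ×
  (∀ q → Prime q → q ≢ p → exponent q y ≡ exponent q x)

record Geodesic (H H' : ℕ) (γ : List ℕ) : Set where
  constructor geodesic
  field
    positive : All NonZero γ
    starts   : head γ ≡ just H
    ends     : last γ ≡ just H'
    steps    : Linked (Step H') γ

AdmissibleGeodesic : (H H' : ℕ) → List ℕ → Set
AdmissibleGeodesic H H' γ = Geodesic H H' γ × All (_≤ H') γ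

exponent-large : ∀ {p n} → n < p → exponent p n ≡ 0
exponent-large {p} {zero}      _   = refl
exponent-large {p} {n@(suc _)} n<p =
  cong length (filter-none (p ≟_) {xs = factors (factorise n)} (All.tabulate λ m p≡q →
    contradiction n<p (≤⇒≯ (∣⇒≤ (subst₂ _∣_ (sym p≡q)
      (sym (PrimeFactorisation.isFactorisation (factorise n))) (∈⇒∣product m))))))

exponent-pos⇒≤ : ∀ {p n} → 0 < exponent p n → p ≤ n
exponent-pos⇒≤ {p} {n} pos with p ≤? n
... | yes p≤n = p≤n
... | no  p≰n = contradiction (sym (exponent-large (≰⇒> p≰n))) (<⇒≢ pos)

movesTowards⇒≤ : ∀ {H' p x y} → MovesTowards H' p x y → p ≤ x ⊎ p ≤ y
movesTowards⇒≤ (inj₁ (_ , eq)) = inj₂ (exponent-pos⇒≤ (subst (0 <_) (sym eq) z<s))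
movesTowards⇒≤ (inj₂ (_ , eq)) = inj₁ (exponent-pos⇒≤ (subst (0 <_) (sym eq) z<s))

step? : ∀ H' → Decidable (Step H')
step? H' x y = map′ to from (anyUpTo? local? N)
  where
  N = suc (x + y)

  Local : ℕ → Set
  Local p = Prime p × MovesTowards H' p x y ×
    (∀ {q} → q < N → Prime q → q ≢ p → exponent q y ≡ exponent q x)

  local? : ∀ p → Dec (Local p)
  local? p = prime? p
    ×-dec (((exponent p x <? exponent p H') ×-dec (exponent p y ≟ suc (exponent p x)))
      ⊎-dec ((exponent p H' <? exponent p x) ×-dec (exponent p x ≟ suc (exponent p y))))
    ×-dec allUpTo? (λ q → prime? q →-dec (¬? (q ≟ p) →-dec (exponent q y ≟ exponent q x))) N

  to : (∃ λ p → p < N × Local p) → Step H' x y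
  to (p , _ , pp , move , rest) = p , pp , move , rest′
    where
    rest′ : ∀ q → Prime q → q ≢ p → exponent q y ≡ exponent q x
    rest′ q pq q≢p with q <? N
    ... | yes q<N = rest q<N pq q≢p
    ... | no  q≮N = trans (exponent-large (≤-<-trans (m≤n+m y x) x+y<q))
                          (sym (exponent-large (≤-<-trans (m≤m+n x y) x+y<q)))
      where x+y<q = ≮⇒≥ q≮N

  bound : ∀ {p} → p ≤ x ⊎ p ≤ y → p < N
  bound (inj₁ p≤x) = s≤s (≤-trans p≤x (m≤m+n x y))
  bound (inj₂ p≤y) = s≤s (≤-trans p≤y (m≤n+m y x))

  from : Step H' x y → ∃ λ p → p < N × Local p
  from (p , pp , move , rest) =
    p , bound (movesTowards⇒≤ {H'} move) , pp , move , λ {q} _ → rest q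

admissibleGeodesic? : ∀ H H' γ → Dec (AdmissibleGeodesic H H' γ)
admissibleGeodesic? H H' γ =
  map′ (λ (a , b , c , e) → geodesic a b c e) (λ (geodesic a b c e) → a , b , c , e)
    (All.all? nonZero? γ
      ×-dec ≡-dec _≟_ (head γ) (just H)
      ×-dec ≡-dec _≟_ (last γ) (just H')
      ×-dec linked? (step? H') γ)
  ×-dec All.all? (_≤? H') γ

-- All lists over xs of length at most n.
words≤ : ℕ → List ℕ → List (List ℕ)
words≤ zero    xs = [] ∷ []
words≤ (suc n) xs = [] ∷ cartesianProductWith _∷_ xs (words≤ n xs)

latticeDistance : (H' x : ℕ) → ℕ
latticeDistance H' x = sum (map (λ p → ∣ exponent p x - exponent p H' ∣) (primesUpTo H'))

-- The complete list of admissible geodesics: see ∈-admissibleGeodesics below.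
admissibleGeodesics : ℕ → ℕ → List (List ℕ)
admissibleGeodesics H H' =
  filter (admissibleGeodesic? H H') (words≤ (suc (latticeDistance H' H)) (range H'))

-- The initial value d H of the minimum is harmless, since H is a vertex of every geodesic.
bottleneck : ℕ → List ℕ → ℕ
bottleneck H γ = min (d H) (map d γ)

capacity : ℕ → ℕ → ℕ
capacity H H' = max 0 (map (bottleneck H) (admissibleGeodesics H H'))

βgeo : (H H' : ℕ) .{{_ : NonZero H}} → ℚ
βgeo H H' = _/_ (+ capacity H H') (d H) {{d-nonZero H}}

-- Each step strictly decreases the distance to H', which bounds the length of a geodesic
-- and so makes the enumeration above exhaustive.
private
  sum-mono-≤ : ∀ {f g : ℕ → ℕ} ps → (∀ {p} → p ∈ ps → f p ≤ g p) →
               sum (map f ps) ≤ sum (map g ps)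
  sum-mono-≤ []       _  = z≤n
  sum-mono-≤ (p ∷ ps) le = +-mono-≤ (le (here refl)) (sum-mono-≤ ps (λ m → le (there m)))

  sum-mono-< : ∀ {f g : ℕ → ℕ} {p} ps → (∀ {q} → q ∈ ps → f q ≤ g q) →
               p ∈ ps → f p < g p → sum (map f ps) < sum (map g ps)
  sum-mono-< (p ∷ ps) le (here refl) lt = +-mono-<-≤ lt (sum-mono-≤ ps (λ m → le (there m)))
  sum-mono-< (p ∷ ps) le (there m)   lt =
    +-mono-≤-< (le (here refl)) (sum-mono-< ps (λ m′ → le (there m′)) m lt)

  closer : ∀ {H' p x y} → MovesTowards H' p x y →
           ∣ exponent p y - exponent p H' ∣ < ∣ exponent p x - exponent p H' ∣
  closer {H'} {p} {x} (inj₁ (lt , eq)) rewrite eq =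
    subst₂ _<_ (sym (m≤n⇒∣m-n∣≡n∸m lt)) (sym (m≤n⇒∣m-n∣≡n∸m (<⇒≤ lt)))
      (∸-monoʳ-< (n<1+n _) lt)
  closer {H'} {p} {x} {y} (inj₂ (lt , eq)) rewrite eq =
    subst₂ _<_ (sym (m≤n⇒∣n-m∣≡n∸m (s≤s⁻¹ lt))) (sym (m≤n⇒∣n-m∣≡n∸m (<⇒≤ lt)))
      (∸-monoˡ-< (n<1+n _) (s≤s⁻¹ lt))

  distance-decreases : ∀ {H' x y} → x ≤ H' → y ≤ H' → Step H' x y →
                       latticeDistance H' y < latticeDistance H' x
  distance-decreases {H'} {x} {y} x≤ y≤ (p , pp , move , rest) =
    sum-mono-< (primesUpTo H') le
      (∈-filter⁺ prime? (∈-upTo⁺ (s≤s (p≤H' (movesTowards⇒≤ {H'} move)))) pp) (closer {H'} {p} {x} {y} move)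
    where
    p≤H' : p ≤ x ⊎ p ≤ y → p ≤ H'
    p≤H' (inj₁ p≤x) = ≤-trans p≤x x≤
    p≤H' (inj₂ p≤y) = ≤-trans p≤y y≤
    le : ∀ {q} → q ∈ primesUpTo H' →
         ∣ exponent q y - exponent q H' ∣ ≤ ∣ exponent q x - exponent q H' ∣
    le {q} m with q ≟ p
    ... | yes refl = <⇒≤ (closer {H'} {q} {x} {y} move)
    ... | no  q≢p  = ≤-reflexive (cong (λ e → ∣ e - exponent q H' ∣)
                       (rest q (proj₂ (∈-filter⁻ prime? {xs = upTo (suc H')} m)) q≢p))

  length-bound : ∀ {H' x zs} → Linked (Step H') (x ∷ zs) → All (_≤ H') (x ∷ zs) →
                 length zs ≤ latticeDistance H' x
  length-bound [-]      _                  = z≤n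
  length-bound (s ∷ ss) (x≤ ∷ rest@(y≤ ∷ _)) =
    ≤-<-trans (length-bound ss rest) (distance-decreases x≤ y≤ s)

  ∈-words≤ : ∀ {n xs} γ → length γ ≤ n → All (_∈ xs) γ → γ ∈ words≤ n xs
  ∈-words≤ {zero}  []      _       _        = here refl
  ∈-words≤ {suc n} []      _       _        = here refl
  ∈-words≤ {suc n} (z ∷ γ) (s≤s l) (m ∷ ms) =
    there (∈-cartesianProductWith⁺ _∷_ m (∈-words≤ γ l ms))

  ∈-range : ∀ {n z} → NonZero z → z ≤ n → z ∈ range n
  ∈-range {z = suc z} _ z<n = ∈-applyUpTo⁺ suc z<n

∈-admissibleGeodesics : ∀ {H H' γ} → AdmissibleGeodesic H H' γ → γ ∈ admissibleGeodesics H H'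
∈-admissibleGeodesics {H} {H'} {z ∷ γ} ag@(geodesic pos refl ends steps , ≤H') =
  ∈-filter⁺ (admissibleGeodesic? H H')
    (∈-words≤ (z ∷ γ) (s≤s (length-bound steps ≤H'))
      (All.zipWith (λ (nz , le) → ∈-range nz le) (pos , ≤H')))
    ag

capacity-upper : ∀ {H H' γ} → AdmissibleGeodesic H H' γ → bottleneck H γ ≤ capacity H H'
capacity-upper {H} {H'} ag =
  All.lookup (xs≤max 0 (map (bottleneck H) (admissibleGeodesics H H')))
    (∈-map⁺ (bottleneck H) (∈-admissibleGeodesics ag))

capacity-attained : ∀ {H H'} → 0 < capacity H H' →
                    ∃[ γ ] AdmissibleGeodesic H H' γ × bottleneck H γ ≡ capacity H H'
capacity-attained {H} {H'} pos
  with argmax-sel id 0 (map (bottleneck H) (admissibleGeodesics H H'))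
... | inj₁ eq = contradiction (sym eq) (<⇒≢ pos)
... | inj₂ m with ∈-map⁻ (bottleneck H) m
... | γ , γ∈ , eq = γ , proj₂ (∈-filter⁻ (admissibleGeodesic? H H')
                      {xs = words≤ (suc (latticeDistance H' H)) (range H')} γ∈) , sym eq

{-# OPTIONS --safe #-}
-- Write H = rA and H' = qB.  Delete r, insert every required prime except q, delete s,
-- and insert q last: H → A → … → sB → B → H'.  All vertices are at most H', since
-- sB ≤ qB = H'.  Removing one prime factor at most halves d, so the vertices between A and sB
-- have at least d(A) ≥ d(H)/2 divisors, and d(B) ≥ d(H')/2 > d(H)/2.
--
-- If r has exponent 1 in H and 0 in H', every geodesic has a step z → z/r with r ∤ z/r.
-- There z < H', hence d(z) ≤ d(H) by consecutiveness, and d(z/r) = d(z)/2.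
module Submission where

open import Defs
open import Data.Empty using (⊥; ⊥-elim)
import Data.Integer.Base as ℤ
open import Data.Integer.Base using (+_; +≤+)
open import Data.Integer.Properties using (pos-*)
open import Data.List.Base using (List; []; _∷_; _++_; filter; last; length; map)
open import Data.List.Extrema.Nat using (argmin-sel; min≤xs)
open import Data.List.Membership.Propositional using (_∈_)
open import Data.List.Membership.Propositional.Properties using (∈-applyUpTo⁺; ∈-filter⁺; ∈-filter⁻; ∈-∃++; ∈-map⁺; ∈-map⁻; ∈-++⁺ˡ; ∈-++⁺ʳ; ∈-++⁻)
open import Data.List.Properties using (filter-++; filter-accept; filter-reject; length-++; length-map)
open import Data.List.Relation.Binary.Permutation.Propositional.Properties using (filter-↭; shift; ↭-length; ∈-resp-↭)
open import Data.List.Relation.Binary.Subset.Propositional using (_⊆_)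
open import Data.List.Relation.Unary.All as All using (All; []; _∷_)
open import Data.List.Relation.Unary.All.Properties using (++⁺)
open import Data.List.Relation.Unary.AllPairs using ([]; _∷_)
open import Data.List.Relation.Unary.Any using (here; there)
open import Data.List.Relation.Unary.Linked using (Linked; [-]; _∷_)
open import Data.List.Relation.Unary.Unique.Propositional using (Unique)
open import Data.List.Relation.Unary.Unique.Propositional.Properties as Unique using ()
open import Data.Maybe.Base using (just)
open import Data.Nat.Base
open import Data.Nat.Divisibility
open import Data.Nat.Induction using (<-rec)
open import Data.Nat.ListAction using (product)
open import Data.Nat.ListAction.Properties using (product-++; ∈⇒∣product)
open import Data.Nat.Primality using (Prime; euclidsLemma; prime⇒nonZero; productOfPrimes≢0)
open import Data.Nat.Primality.Factorisation using (PrimeFactorisation; factorise; factors; factorisationUnique; primeFactorisation[p])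
open import Data.Nat.Properties
open import Data.Product using (_×_; _,_; ∃-syntax; proj₁; proj₂)
open import Data.Rational.Base using (½) renaming (_≤_ to _≤ℚ_; _/_ to _/ℚ_)
open import Data.Rational.Properties using (toℚᵘ-cancel-≤; toℚᵘ-fromℚᵘ; fromℚᵘ-cong)
open import Data.Rational.Unnormalised.Base using (mkℚᵘ; *≤*; *≡*)
open import Data.Rational.Unnormalised.Properties using (≤-respʳ-≃; ≃-sym)
open import Data.Sum.Base using (_⊎_; inj₁; inj₂; [_,_]′)
open import Function.Base using (id)
open import Relation.Binary.Construct.Closure.ReflexiveTransitive using (Star; ε; _◅_; _◅◅_)
open import Relation.Binary.PropositionalEquality using (_≡_; _≢_; refl; sym; trans; cong; cong₂; subst; subst₂; module ≡-Reasoning)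
open import Relation.Nullary using (yes; no; contradiction)

open PrimeFactorisation using (isFactorisation; factorsPrime)

-- Exponents

-- Prime factorisations are unique up to permutation, so the multiplicity can be read off any of
-- them. For a product this will be the concatenation of two factorisations, for a prime the
-- one-element list.
exponent-factorisation : ∀ p {n} .{{_ : NonZero n}} (f : PrimeFactorisation n) →
  exponent p n ≡ length (filter (p ≟_) (factors f))
exponent-factorisation p {suc n} f =
  ↭-length (filter-↭ (p ≟_) (factorisationUnique (factorise (suc n)) f))

exponent-* : ∀ p m n .{{_ : NonZero m}} .{{_ : NonZero n}} →
  exponent p (m * n) ≡ exponent p m + exponent p n
exponent-* p m n = begin
  exponent p (m * n)                                 ≡⟨ exponent-factorisation p {{m*n≢0 m n}} fg ⟩
  length (filter (p ≟_) (factors f ++ factors g))    ≡⟨ cong length (filter-++ (p ≟_) (factors f) (factors g)) ⟩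
  length (filter (p ≟_) (factors f) ++ filter (p ≟_) (factors g))
                                                     ≡⟨ length-++ (filter (p ≟_) (factors f)) ⟩
  length (filter (p ≟_) (factors f)) + length (filter (p ≟_) (factors g))
                                                     ≡⟨ cong₂ _+_ (exponent-factorisation p f) (exponent-factorisation p g) ⟨
  exponent p m + exponent p n                        ∎
  where
  open ≡-Reasoning
  f = factorise m
  g = factorise n
  fg : PrimeFactorisation (m * n)
  fg = record
    { factors = factors f ++ factors g
    ; isFactorisation = trans (cong₂ _*_ (isFactorisation f) (isFactorisation g))
                              (sym (product-++ (factors f) (factors g)))
    ; factorsPrime = ++⁺ (factorsPrime f) (factorsPrime g)
    }

exponent-self : ∀ {p} → Prime p → exponent p p ≡ 1
exponent-self {p} pp = trans (exponent-factorisation p {{prime⇒nonZero pp}} (primeFactorisation[p] pp))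
  (cong length (filter-accept (p ≟_) {xs = []} refl))

exponent-≢ : ∀ {p q} → Prime p → q ≢ p → exponent q p ≡ 0
exponent-≢ {p} {q} pp q≢p = trans (exponent-factorisation q {{prime⇒nonZero pp}} (primeFactorisation[p] pp))
  (cong length (filter-reject (q ≟_) {xs = []} q≢p))

exponent-*-self : ∀ {p} n .{{_ : NonZero n}} → Prime p → exponent p (p * n) ≡ suc (exponent p n)
exponent-*-self {p} n pp =
  trans (exponent-* p p n {{prime⇒nonZero pp}}) (cong (_+ exponent p n) (exponent-self pp))

exponent-*-≢ : ∀ {p q} n .{{_ : NonZero n}} → Prime p → q ≢ p → exponent q (p * n) ≡ exponent q n
exponent-*-≢ {p} {q} n pp q≢p =
  trans (exponent-* q p n {{prime⇒nonZero pp}}) (cong (_+ exponent q n) (exponent-≢ pp q≢p))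

exponent-mono-∣ : ∀ p {m n} .{{_ : NonZero n}} → m ∣ n → exponent p m ≤ exponent p n
exponent-mono-∣ p {m} {{nz}} (divides c refl) =
  subst (exponent p m ≤_) (sym (exponent-* p c m {{m*n≢0⇒m≢0 c}} {{m*n≢0⇒n≢0 c}}))
    (m≤n+m (exponent p m) (exponent p c))

exponent-pos⇒∣ : ∀ {p n} → 0 < exponent p n → p ∣ n
exponent-pos⇒∣ {p} {suc n} pos with filter (p ≟_) (factors (factorise (suc n))) in eq
... | x ∷ _ with ∈-filter⁻ (p ≟_) {xs = factors (factorise (suc n))} (subst (x ∈_) (sym eq) (here refl))
...   | x∈ , refl = subst (p ∣_) (sym (isFactorisation (factorise (suc n)))) (∈⇒∣product x∈)

exponent-∤ : ∀ {p n} .{{_ : NonZero n}} → Prime p → exponent p n ≡ 0 → p ∤ n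
exponent-∤ {p} pp eq p∣n with subst₂ _≤_ (exponent-self pp) eq (exponent-mono-∣ p p∣n)
... | ()

-- Induction on the prime factors of `m`. The leading prime has positive exponent in `n`, hence
-- divides `n`, and cancelling it on both sides keeps the inequalities between the remaining
-- exponents.
exponent-≤⇒∣ : ∀ {m n} .{{_ : NonZero m}} .{{_ : NonZero n}} →
  (∀ p → Prime p → exponent p m ≤ exponent p n) → m ∣ n
exponent-≤⇒∣ {m} {n} le = subst (_∣ n) (sym (isFactorisation (factorise m)))
  (go (factorsPrime (factorise m)) n λ p pp →
    subst (λ x → exponent p x ≤ exponent p n) (isFactorisation (factorise m)) (le p pp))
  where
  go : ∀ {ps} → All Prime ps → ∀ n .{{_ : NonZero n}} →
       (∀ p → Prime p → exponent p (product ps) ≤ exponent p n) → product ps ∣ n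
  go []                       n le = 1∣ n
  go (_∷_ {p} {ps} pp primes) n le
    with exponent-pos⇒∣ {p} {n} (≤-trans (subst (0 <_)
      (sym (exponent-*-self (product ps) {{productOfPrimes≢0 primes}} pp)) z<s) (le p pp))
  ... | divides c refl = subst (p * product ps ∣_) (*-comm p c)
    (*-monoʳ-∣ p (go primes c {{m*n≢0⇒m≢0 c}} λ q pq → +-cancelˡ-≤ (exponent q p) _ _
      (subst₂ _≤_ (exponent-* q p (product ps) {{prime⇒nonZero pp}} {{productOfPrimes≢0 primes}})
                  (trans (cong (exponent q) (*-comm c p)) (exponent-* q p c {{prime⇒nonZero pp}} {{m*n≢0⇒m≢0 c}}))
                  (le q pq))))

-- Turns a lattice step, which speaks only of exponents, back into arithmetic. The two numbers are
-- in fact equal, but divisibility is enough to compare their divisor counts.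
p*m∣n : ∀ {p m n} .{{_ : NonZero m}} .{{_ : NonZero n}} → Prime p → exponent p n ≡ suc (exponent p m) →
  (∀ q → Prime q → q ≢ p → exponent q m ≡ exponent q n) → p * m ∣ n
p*m∣n {p} {m} {n} pp eq rest = exponent-≤⇒∣ {{m*n≢0 p m {{prime⇒nonZero pp}}}} le
  where
  le : ∀ q → Prime q → exponent q (p * m) ≤ exponent q n
  le q pq with q ≟ p
  ... | yes refl = ≤-reflexive (trans (exponent-*-self m pp) (sym eq))
  ... | no  q≢p  = ≤-reflexive (trans (exponent-*-≢ m pp q≢p) (rest q pq q≢p))

-- Number of divisors

-- A pigeonhole principle, by which divisor counts are compared through inclusions of divisor lists.
-- The head of `xs` is cut out of `ys`; by uniqueness the tail still embeds in what is left.
Unique-⊆⇒length-≤ : ∀ {A : Set} {xs ys : List A} → Unique xs → xs ⊆ ys → length xs ≤ length ys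
Unique-⊆⇒length-≤                 []           _     = z≤n
Unique-⊆⇒length-≤ {xs = x ∷ xs} (x∉ ∷ unique) xs⊆ys with ∈-∃++ (xs⊆ys (here refl))
... | us , vs , refl = subst (suc (length xs) ≤_) (sym (↭-length (shift x us vs)))
  (s≤s (Unique-⊆⇒length-≤ unique xs⊆))
  where
  xs⊆ : xs ⊆ us ++ vs
  xs⊆ y∈ with ∈-resp-↭ (shift x us vs) (xs⊆ys (there y∈))
  ... | here refl = contradiction refl (All.lookup x∉ y∈)
  ... | there y∈′ = y∈′

divisors : ℕ → List ℕ
divisors n = filter (_∣? n) (range n)

divisors-unique : ∀ n → Unique (divisors n)
divisors-unique n = Unique.filter⁺ (_∣? n)
  (Unique.applyUpTo⁺₁ suc n λ i<j _ eq → <⇒≢ i<j (suc-injective eq))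

∣⇒∈divisors : ∀ {e n} .{{_ : NonZero n}} → e ∣ n → e ∈ divisors n
∣⇒∈divisors {zero}  {suc n} 0∣n = contradiction (0∣⇒≡0 0∣n) λ ()
∣⇒∈divisors {suc e} {n}     e∣n = ∈-filter⁺ (_∣? n) (∈-applyUpTo⁺ suc (∣⇒≤ e∣n)) e∣n

∈divisors⇒∣ : ∀ {e n} → e ∈ divisors n → e ∣ n
∈divisors⇒∣ {n = n} e∈ = proj₂ (∈-filter⁻ (_∣? n) {xs = range n} e∈)

d-mono-∣ : ∀ {m n} .{{_ : NonZero n}} → m ∣ n → d m ≤ d n
d-mono-∣ {m} m∣n = Unique-⊆⇒length-≤ (divisors-unique m)
  λ e∈ → ∣⇒∈divisors (∣-trans (∈divisors⇒∣ e∈) m∣n)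

-- In `p * n ≡ c * e` the prime `p` divides `c` or `e` by Euclid's lemma. In the first case it
-- cancels from the cofactor and `e` divides `n`; in the second it cancels from `e`.
∣p*n⇒ : ∀ {p e n} → Prime p → e ∣ p * n → e ∣ n ⊎ ∃[ f ] (e ≡ p * f × f ∣ n)
∣p*n⇒ {p} {e} {n} pp (divides c eq) with euclidsLemma c e pp (divides n (trans (sym eq) (*-comm p n)))
... | inj₁ (divides b refl) = inj₁ (divides b (*-cancelˡ-≡ n (b * e) p {{prime⇒nonZero pp}}
  (trans eq (trans (cong (_* e) (*-comm b p)) (*-assoc p b e)))))
... | inj₂ (divides f refl) = inj₂ (f , *-comm f p , *-cancelˡ-∣ p {{prime⇒nonZero pp}}
  (divides c (trans eq (cong (c *_) (*-comm f p)))))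

length-divisors-++ : ∀ p n → length (divisors n ++ map (p *_) (divisors n)) ≡ 2 * d n
length-divisors-++ p n = trans (length-++ (divisors n))
  (cong (λ x → d n + x) (trans (length-map (p *_) (divisors n)) (sym (+-identityʳ (d n)))))

d[p*n]≤2*d[n] : ∀ {p n} .{{_ : NonZero n}} → Prime p → d (p * n) ≤ 2 * d n
d[p*n]≤2*d[n] {p} {n} pp = subst (d (p * n) ≤_) (length-divisors-++ p n)
  (Unique-⊆⇒length-≤ (divisors-unique (p * n)) sub)
  where
  sub : divisors (p * n) ⊆ divisors n ++ map (p *_) (divisors n)
  sub e∈ with ∣p*n⇒ pp (∈divisors⇒∣ e∈)
  ... | inj₁ e∣n              = ∈-++⁺ˡ (∣⇒∈divisors e∣n)
  ... | inj₂ (f , refl , f∣n) = ∈-++⁺ʳ (divisors n) (∈-map⁺ (p *_) (∣⇒∈divisors f∣n))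

-- The divisors of `n` and their multiples by `p` all divide `p * n`. The two lists are disjoint,
-- since a common entry would make `p` divide `n`.
2*d[n]≤d[p*n] : ∀ {p n} .{{_ : NonZero n}} → Prime p → p ∤ n → 2 * d n ≤ d (p * n)
2*d[n]≤d[p*n] {p} {n} pp p∤n = subst (_≤ d (p * n)) (length-divisors-++ p n)
  (Unique-⊆⇒length-≤ unique sub)
  where
  instance _ = prime⇒nonZero pp
  unique : Unique (divisors n ++ map (p *_) (divisors n))
  unique = Unique.++⁺ (divisors-unique n)
    (Unique.map⁺ (λ {x} {y} → *-cancelˡ-≡ x y p) (divisors-unique n)) disjoint
    where
    disjoint : ∀ {e} → e ∈ divisors n × e ∈ map (p *_) (divisors n) → ⊥
    disjoint (e∈ , e∈′) with ∈-map⁻ (p *_) e∈′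
    ... | f , _ , refl = p∤n (∣-trans (m∣m*n f) (∈divisors⇒∣ e∈))
  sub : divisors n ++ map (p *_) (divisors n) ⊆ divisors (p * n)
  sub e∈ with ∈-++⁻ (divisors n) e∈
  ... | inj₁ e∈′ = ∣⇒∈divisors {{m*n≢0 p n}} (∣n⇒∣m*n p (∈divisors⇒∣ e∈′))
  ... | inj₂ e∈′ with ∈-map⁻ (p *_) e∈′
  ...   | f , f∈ , refl = ∣⇒∈divisors {{m*n≢0 p n}} (*-monoʳ-∣ p (∈divisors⇒∣ f∈))

-- The least m with d(H) < d(m) would be a highly composite number between H and H'.
consecutive⇒d≤ : ∀ {H H'} → Consecutive H H' → ∀ m → 1 ≤ m → m < H' → d m ≤ d H
consecutive⇒d≤ {H} {H'} ((_ , hcH) , _ , _ , gap) =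
  <-rec (λ m → 1 ≤ m → m < H' → d m ≤ d H) step
  where
  step : ∀ m → (∀ {i} → i < m → 1 ≤ i → i < H' → d i ≤ d H) → 1 ≤ m → m < H' → d m ≤ d H
  step m ih 1≤m m<H' with d m ≤? d H
  ... | yes le = le
  ... | no  nle = ⊥-elim (gap m H<m m<H'
      (1≤m , λ i 1≤i i<m → ≤-<-trans (ih i<m 1≤i (<-trans i<m m<H')) dH<dm))
    where
    dH<dm = ≰⇒> nle
    H<m : H < m
    H<m with H <? m
    ... | yes lt = lt
    ... | no  nlt with m≤n⇒m<n∨m≡n (≮⇒≥ nlt)
    ...   | inj₁ m<H  = contradiction (hcH m 1≤m m<H) (<⇒≯ dH<dm)
    ...   | inj₂ refl = contradiction dH<dm (<-irrefl refl)

-- Geodesics as paths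

-- Everything asked of a single vertex for the lower bound: admissibility, and at least half of
-- `d H` divisors, doubled to stay in the natural numbers.
record Vertex (H H' z : ℕ) : Set where
  constructor vertex
  field
    vertex≢0 : NonZero z
    ≤H'      : z ≤ H'
    dH≤2*d   : d H ≤ 2 * d z

open Vertex

-- Only the source carries a vertex condition, so that in a concatenated path every vertex but the
-- last is checked exactly once; the last one is supplied separately.
record Edge (H H' x y : ℕ) : Set where
  constructor edge
  field
    source : Vertex H H' x
    step   : Step H' x y

path⇒list : ∀ {H H' x y} → Star (Edge H H') x y → Vertex H H' y →
  ∃[ zs ] (Linked (Step H') (x ∷ zs) × last (x ∷ zs) ≡ just y × All (Vertex H H') (x ∷ zs))
path⇒list ε                     vy = [] , [-] , refl , vy ∷ []
path⇒list (edge vx step ◅ path) vy with path⇒list path vy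
... | zs , linked , eq , vs = _ , step ∷ linked , eq , vx ∷ vs

dH≤2*bottleneck : ∀ {H H' γ} → All (Vertex H H') γ → d H ≤ 2 * bottleneck H γ
dH≤2*bottleneck {H} {H'} {γ} vs with argmin-sel id (d H) (map d γ)
-- The minimum may be its initial value `d H`, for which the bound is immediate.
... | inj₁ eq = subst (λ x → d H ≤ 2 * x) (sym eq) (m≤n*m (d H) 2)
... | inj₂ m∈ with ∈-map⁻ d m∈
...   | z , z∈ , eq = subst (λ x → d H ≤ 2 * x) (sym eq) (dH≤2*d (All.lookup vs z∈))

path⇒dH≤2*capacity : ∀ {H H'} → Star (Edge H H') H H' → Vertex H H' H' → d H ≤ 2 * capacity H H'
path⇒dH≤2*capacity {H} {H'} path v with path⇒list path v
... | zs , linked , eq , vs = ≤-trans (dH≤2*bottleneck vs)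
  (*-monoʳ-≤ 2 (capacity-upper (geodesic (All.map vertex≢0 vs) refl eq linked , All.map ≤H' vs)))

insertionStep : ∀ {H' p} x .{{_ : NonZero x}} → Prime p → exponent p x < exponent p H' → Step H' x (p * x)
insertionStep {p = p} x pp lt =
  p , pp , inj₁ (lt , exponent-*-self x pp) , λ _ _ q≢p → exponent-*-≢ x pp q≢p

deletionStep : ∀ {H' p} x .{{_ : NonZero x}} → Prime p → exponent p H' < exponent p (p * x) → Step H' (p * x) x
deletionStep {p = p} x pp lt =
  p , pp , inj₂ (lt , exponent-*-self x pp) , λ _ _ q≢p → sym (exponent-*-≢ x pp q≢p)

-- The prime factors of `y / x` are multiplied on one at a time. All intermediate numbers lie
-- between `x` and `y` in the divisibility order, so it suffices to check the vertex condition
-- there. The hypothesis on exponents makes each multiplication a move towards `H'`.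
insertionPath : ∀ {H H' x y} .{{_ : NonZero y}} → x ∣ y →
  (∀ p → Prime p → exponent p x < exponent p y → exponent p y ≤ exponent p H') →
  (∀ {z} → x ∣ z → z ∣ y → Vertex H H' z) → Star (Edge H H') x y
insertionPath {H} {H'} {x} {y} {{nz}} (divides c y≡c*x) = go x (factorsPrime f)
  (trans (cong (x *_) (sym (isFactorisation f))) (trans (*-comm x c) (sym y≡c*x)))
  where
  instance _ = m*n≢0⇒m≢0 c {x} {{subst NonZero y≡c*x nz}}
  f = factorise c
  go : ∀ x {ps} → All Prime ps → x * product ps ≡ y →
       (∀ p → Prime p → exponent p x < exponent p y → exponent p y ≤ exponent p H') →
       (∀ {z} → x ∣ z → z ∣ y → Vertex H H' z) → Star (Edge H H') x y
  go x [] eq _ _ = subst (Star _ x) (trans (sym (*-identityʳ x)) eq) ε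
  go x (_∷_ {p} {ps} pp primes) eq target vertices =
    edge vx (insertionStep {H'} x pp (<-≤-trans x<y (target p pp x<y))) ◅
    go (p * x) primes eq′
      (λ q pq lt → target q pq (≤-<-trans (exponent-mono-∣ q {{nz*}} (n∣m*n p)) lt))
      (λ px∣z → vertices (∣-trans (n∣m*n p) px∣z))
    where
    eq′ : p * x * product ps ≡ y
    eq′ = trans (cong (_* product ps) (*-comm p x)) (trans (*-assoc x p (product ps)) eq)
    vx = vertices ∣-refl (divides (p * product ps) (trans (sym eq) (*-comm x (p * product ps))))
    instance _ = vertex≢0 vx
    nz* = m*n≢0 p x {{prime⇒nonZero pp}}
    -- `p * x` still divides `y`, so `y` has at least one more factor `p` than `x`.
    x<y : exponent p x < exponent p y
    x<y = subst (_≤ exponent p y) (exponent-*-self x pp)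
      (exponent-mono-∣ p {p * x} (divides (product ps) (trans (sym eq′) (*-comm (p * x) (product ps)))))

-- Upper bound

-- The exponent of `r` starts positive and ends at 0. The witness `z` is the first vertex where it
-- vanishes; the step into `z` must move the coordinate `r` downwards by one, so its source `y` has
-- exponent 1.
supportDeletion : ∀ {r H' x zs} → Prime r → Linked (Step H') (x ∷ zs) → last (x ∷ zs) ≡ just H' →
  0 < exponent r x → exponent r H' ≡ 0 →
  ∃[ y ] ∃[ z ] (y ∈ x ∷ zs × z ∈ x ∷ zs × exponent r y ≡ 1 × exponent r z ≡ 0 ×
    (∀ q → Prime q → q ≢ r → exponent q z ≡ exponent q y))
supportDeletion _ [-] refl pos eq0 = contradiction (sym eq0) (<⇒≢ pos)
supportDeletion {r} {x = x} {y ∷ zs} pr ((p , _ , moves , rest) ∷ linked) ends pos eq0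
  with exponent r y in eq | r ≟ p | moves
... | zero  | yes refl | inj₁ (_ , eq′) = contradiction (trans (sym eq) eq′) 0≢1+n
... | zero  | yes refl | inj₂ (_ , eq′) =
  x , y , here refl , there (here refl) , trans eq′ (cong suc eq) , eq , rest
... | zero  | no r≢p   | _ = contradiction (trans (sym eq) (rest r pr r≢p)) (<⇒≢ pos)
... | suc _ | _        | _
  with supportDeletion {r} pr linked ends (subst (0 <_) (sym eq) z<s) eq0
...   | a , b , a∈ , b∈ , facts = a , b , there a∈ , there b∈ , facts

-- Positivity of the capacity ensures that the maximum is attained by a geodesic and is not just its
-- initial value 0. The support deletion is then located on that optimal geodesic.
2*capacity≤dH : ∀ {r H H'} → Consecutive H H' → Prime r → 0 < exponent r H → exponent r H' ≡ 0 →
  0 < capacity H H' → 2 * capacity H H' ≤ d H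
2*capacity≤dH {r} {H} {H'} consecutive pr pos eq0 cap
  with capacity-attained cap
... | x ∷ zs , (geodesic nzs refl ends linked , ≤H') , eq
  with supportDeletion {r} pr linked ends pos eq0
... | y , z , y∈ , z∈ , y≡1 , z≡0 , rest = begin
  2 * capacity H H'              ≡⟨ cong (2 *_) eq ⟨
  2 * bottleneck H (x ∷ zs)      ≤⟨ *-monoʳ-≤ 2 (All.lookup (min≤xs (d H) (map d (x ∷ zs))) (∈-map⁺ d z∈)) ⟩
  2 * d z                        ≤⟨ 2*d[n]≤d[p*n] pr (exponent-∤ pr z≡0) ⟩
  d (r * z)                      ≤⟨ d-mono-∣ {r * z} {y} (p*m∣n {r} {z} {y} pr (trans y≡1 (cong suc (sym z≡0))) rest) ⟩
  d y                            ≤⟨ consecutive⇒d≤ consecutive y (>-nonZero⁻¹ y) (≤∧≢⇒< (All.lookup ≤H' y∈) y≢H') ⟩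
  d H                            ∎
  where
  open ≤-Reasoning
  instance
    _ = prime⇒nonZero pr
    nzy = All.lookup nzs y∈
    nzz = All.lookup nzs z∈
  -- Strictness is needed to apply `consecutive⇒d≤`: the prime `r` has exponent 1 in `y` but 0 in
  -- `H'`.
  y≢H' : y ≢ H'
  y≢H' refl = contradiction (trans (sym eq0) y≡1) 0≢1+n

-- Lower bound

module _ {H H' r j s k} (order : AdmissibleDeletionOrder H H' ((r , j) ∷ (s , k) ∷ [])) where

  open AdmissibleDeletionOrder order

  private
    pr = proj₁ (All.head required)
    ps = proj₁ (All.head (All.tail required))

    layer : ∀ p i → Prime p → exponent p H' < i → i ≤ exponent p H → (p ≡ r × i ≡ j) ⊎ (p ≡ s × i ≡ k)
    layer p i pp lo hi with complete (p , i) (pp , lo , hi)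
    ... | here refl         = inj₁ (refl , refl)
    ... | there (here refl) = inj₂ (refl , refl)

  -- In terms of divisibility, `H` divides `r * s * H'`. Were the bound violated at `p`, the levels
  -- just above the exponent of `p` in `H'` would give more required layers at `p` than the deletion
  -- order lists there.
  exponent-H≤ : ∀ p → Prime p → exponent p H ≤ exponent p r + (exponent p s + exponent p H')
  exponent-H≤ p pp with p ≟ r | p ≟ s
  ... | no p≢r   | no p≢s   rewrite exponent-≢ pr p≢r | exponent-≢ ps p≢s = ≮⇒≥ λ lt →
    [ (λ (p≡r , _) → p≢r p≡r) , (λ (p≡s , _) → p≢s p≡s) ]′ (layer p (exponent p H) pp lt ≤-refl)
  -- Only one listed layer has base `p`, but two consecutive levels would both have to be that
  -- layer.
  ... | yes refl | no p≢s   rewrite exponent-self pr | exponent-≢ ps p≢s = ≮⇒≥ λ lt →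
    absurd (layer p _ pp (n<1+n _) (<⇒≤ lt)) (layer p _ pp (m<n⇒m<1+n (n<1+n _)) lt)
    where
    absurd : ∀ {b} → (p ≡ p × suc b ≡ j) ⊎ (p ≡ s × suc b ≡ k) →
             (p ≡ p × suc (suc b) ≡ j) ⊎ (p ≡ s × suc (suc b) ≡ k) → ⊥
    absurd (inj₂ (p≡s , _))  _                 = p≢s p≡s
    absurd (inj₁ _)          (inj₂ (p≡s , _))  = p≢s p≡s
    absurd (inj₁ (_ , refl)) (inj₁ (_ , ()))
  ... | no p≢r   | yes refl rewrite exponent-self ps | exponent-≢ pr p≢r = ≮⇒≥ λ lt →
    absurd (layer p _ pp (n<1+n _) (<⇒≤ lt)) (layer p _ pp (m<n⇒m<1+n (n<1+n _)) lt)
    where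
    absurd : ∀ {b} → (p ≡ r × suc b ≡ j) ⊎ (p ≡ p × suc b ≡ k) →
             (p ≡ r × suc (suc b) ≡ j) ⊎ (p ≡ p × suc (suc b) ≡ k) → ⊥
    absurd (inj₁ (p≡r , _))  _                 = p≢r p≡r
    absurd (inj₂ _)          (inj₁ (p≡r , _))  = p≢r p≡r
    absurd (inj₂ (_ , refl)) (inj₂ (_ , ()))
  -- Both layers have base `p`, so the bound allows two deletions; a violation yields three distinct
  -- levels for the two values `j` and `k`.
  ... | yes refl | yes refl rewrite exponent-self pr = ≮⇒≥ λ lt → absurd
    (layer p _ pp (n<1+n _) (<⇒≤ (<⇒≤ lt)))
    (layer p _ pp (m<n⇒m<1+n (n<1+n _)) (<⇒≤ lt))
    (layer p _ pp (m<n⇒m<1+n (m<n⇒m<1+n (n<1+n _))) lt)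
    where
    absurd : ∀ {b} → (p ≡ p × suc b ≡ j) ⊎ (p ≡ p × suc b ≡ k) →
             (p ≡ p × 2 + b ≡ j) ⊎ (p ≡ p × 2 + b ≡ k) →
             (p ≡ p × 3 + b ≡ j) ⊎ (p ≡ p × 3 + b ≡ k) → ⊥
    absurd (inj₁ (_ , refl)) (inj₁ (_ , ()))
    absurd (inj₁ (_ , refl)) (inj₂ (_ , refl)) (inj₁ (_ , ()))
    absurd (inj₁ (_ , refl)) (inj₂ (_ , refl)) (inj₂ (_ , ()))
    absurd (inj₂ (_ , refl)) (inj₂ (_ , ()))
    absurd (inj₂ (_ , refl)) (inj₁ (_ , refl)) (inj₁ (_ , ()))
    absurd (inj₂ (_ , refl)) (inj₁ (_ , refl)) (inj₂ (_ , ()))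

  -- Ensures that the layer of `s` is still there to be deleted once `r` is gone. For `s ≢ r` the
  -- first summand is 0. For `s ≡ r` the descending order gives `k < j`, so the exponent in `H`
  -- exceeds the one in `H'` by at least 2.
  exponent-s≤ : exponent s r + suc (exponent s H') ≤ exponent s H
  exponent-s≤ with s ≟ r | required | descending
  ... | no s≢r   | _ ∷ (_ , lo , hi) ∷ []            | _ rewrite exponent-≢ pr s≢r = <-≤-trans lo hi
  ... | yes refl | (_ , _ , hi) ∷ (_ , lo , _) ∷ [] | (desc ∷ []) ∷ _ rewrite exponent-self pr =
    ≤-trans (s≤s lo) (≤-trans (desc refl) hi)

  private
    r>H' : exponent r H' < exponent r H
    r>H' = let (_ , lo , hi) = All.head required in <-≤-trans lo hi

  dH≤2*capacity : .{{_ : NonZero H}} → Consecutive H H' →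
    ∃[ q ] (s ≤ q × RequiredInsertionBase H H' q) → d H ≤ 2 * capacity H H'
  dH≤2*capacity (_ , (1≤H' , hcH') , H<H' , _) (q , s≤q , pq , q<)
    with exponent-pos⇒∣ {r} {H} (≤-<-trans z≤n r>H')
       | exponent-pos⇒∣ {q} {H'} (≤-<-trans z≤n q<)
  ... | divides A H≡A*r | divides B H'≡B*q = path⇒dH≤2*capacity
    (edge vH stepA ◅ insertionPath A∣T target vertices ◅◅ edge vT stepB ◅ edge vB stepH' ◅ ε) vH'
    where
    H≡ : H ≡ r * A
    H≡ = trans H≡A*r (*-comm A r)
    H'≡ : H' ≡ q * B
    H'≡ = trans H'≡B*q (*-comm B q)
    T = s * B
    instance
      nzH' : NonZero H'
      nzH' = >-nonZero 1≤H'
      nzH : NonZero H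
      nzH = >-nonZero (>-nonZero⁻¹ H)
      nzA : NonZero A
      nzA = m*n≢0⇒m≢0 A {{subst NonZero H≡A*r nzH}}
      nzB : NonZero B
      nzB = m*n≢0⇒m≢0 B {{subst NonZero H'≡B*q nzH'}}
      nzs = prime⇒nonZero ps
      nzr = prime⇒nonZero pr
      nzT : NonZero T
      nzT = m*n≢0 s B
    dH<dH' = hcH' H (>-nonZero⁻¹ H) H<H'
    s>H' : exponent s H' < exponent s H
    s>H' = ≤-trans (m≤n+m _ (exponent s r)) exponent-s≤
    s≢q : s ≢ q
    s≢q refl = <-asym s>H' q<
    eqA : ∀ p → exponent p H ≡ exponent p r + exponent p A
    eqA p = trans (cong (exponent p) H≡) (exponent-* p r A)
    eqB : exponent s B ≡ exponent s H'
    eqB = sym (trans (cong (exponent s) H'≡) (exponent-*-≢ B pq s≢q))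
    B≤ : ∀ p → exponent p B ≤ exponent p H'
    B≤ p = exponent-mono-∣ p (divides q H'≡)

    -- After adding the exponents of `r` to both sides, this asks that `H` divide `r * s * B`.
    A∣T : A ∣ T
    A∣T = exponent-≤⇒∣ λ p pp → +-cancelˡ-≤ (exponent p r) _ _
      (subst₂ (λ a b → a ≤ exponent p r + b) (eqA p) (sym (exponent-* p s B)) (le p pp))
      where
      le : ∀ p → Prime p → exponent p H ≤ exponent p r + (exponent p s + exponent p B)
      le p pp with p ≟ q
      -- `B` has one factor `q` less than `H'`, which is harmless because `H'` has strictly more of
      -- them than `H`.
      ... | yes refl = ≤-trans
        (s≤s⁻¹ (subst (exponent p H <_) (trans (cong (exponent p) H'≡) (exponent-*-self B pq)) q<))
        (≤-trans (m≤n+m _ (exponent p s)) (m≤n+m _ (exponent p r)))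
      ... | no  p≢q  = subst (λ b → exponent p H ≤ exponent p r + (exponent p s + b))
        (trans (cong (exponent p) H'≡) (exponent-*-≢ B pq p≢q)) (exponent-H≤ p pp)

    target : ∀ p → Prime p → exponent p A < exponent p T → exponent p T ≤ exponent p H'
    target p pp lt with p ≟ s
    ... | no  p≢s  = subst (_≤ exponent p H') (sym (exponent-*-≢ B ps p≢s)) (B≤ p)
    -- `T` has one factor `s` more than `H'`, but `A` already has at least as many, by
    -- `exponent-s≤`. So `s` is never inserted on the way from `A` to `T`.
    ... | yes refl = contradiction lt (≤⇒≯ (subst (_≤ exponent p A)
      (sym (trans (exponent-*-self B ps) (cong suc eqB)))
      (+-cancelˡ-≤ (exponent p r) _ _ (subst (exponent p r + suc (exponent p H') ≤_) (eqA p) exponent-s≤))))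

    vH : Vertex H H' H
    vH = vertex nzH (<⇒≤ H<H') (m≤n*m (d H) 2)
    vH' : Vertex H H' H'
    vH' = vertex nzH' ≤-refl (≤-trans (<⇒≤ dH<dH') (m≤n*m (d H') 2))
    vertices : ∀ {z} → A ∣ z → z ∣ T → Vertex H H' z
    vertices {z} A∣z z∣T = vertex nzz
      (≤-trans (∣⇒≤ z∣T) (subst (T ≤_) (sym H'≡) (*-monoˡ-≤ B s≤q)))
      (≤-trans (subst (λ x → d x ≤ 2 * d A) (sym H≡) (d[p*n]≤2*d[n] pr))
               (*-monoʳ-≤ 2 (d-mono-∣ {{nzz}} A∣z)))
      where
      nzz : NonZero z
      nzz = ≢-nonZero λ { refl → ≢-nonZero⁻¹ T (0∣⇒≡0 z∣T) }
    vT = vertices A∣T ∣-refl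
    vB : Vertex H H' B
    vB = vertex nzB (∣⇒≤ (divides q H'≡))
      (≤-trans (<⇒≤ dH<dH') (subst (λ x → d x ≤ 2 * d B) (sym H'≡) (d[p*n]≤2*d[n] pq)))

    stepA : Step H' H A
    stepA = subst (λ x → Step H' x A) (sym H≡) (deletionStep {H'} A pr
      (subst (λ x → exponent r H' < exponent r x) H≡ r>H'))
    stepB : Step H' T B
    stepB = deletionStep {H'} B ps (≤-reflexive (sym (trans (exponent-*-self B ps) (cong suc eqB))))
    stepH' : Step H' B H'
    stepH' = subst (Step H' B) (sym H'≡) (insertionStep {H'} B pq
      (≤-reflexive (sym (trans (cong (exponent q) H'≡) (exponent-*-self B pq)))))

-- Comparison with one half in the rationals

½≤/ : ∀ m n .{{_ : NonZero n}} → n ≤ 2 * m → ½ ≤ℚ (+ m /ℚ n)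
-- In unnormalised fractions the claim is a cross-multiplied inequality, with no reduction to lowest
-- terms. `mkℚᵘ` stores the denominator minus one, hence the `suc n`.
½≤/ m (suc n) le = toℚᵘ-cancel-≤ (≤-respʳ-≃ (≃-sym (toℚᵘ-fromℚᵘ (mkℚᵘ (+ m) n)))
  (*≤* (subst₂ ℤ._≤_ (pos-* 1 (suc n)) (pos-* m 2)
    (+≤+ (subst₂ _≤_ (sym (*-identityˡ (suc n))) (*-comm 2 m) le)))))

/≡½ : ∀ m n .{{_ : NonZero n}} → n ≡ 2 * m → + m /ℚ n ≡ ½
/≡½ m (suc n) eq = fromℚᵘ-cong {mkℚᵘ (+ m) n} {mkℚᵘ (+ 1) 1}
  (*≡* (trans (sym (pos-* m 2)) (trans
    (cong +_ (trans (*-comm m 2) (trans (sym eq) (sym (*-identityˡ (suc n))))))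
    (pos-* 1 (suc n)))))

theorem6p1 : ∀ (H H' : ℕ) .{{_ : NonZero H}} → Consecutive H H' → L₋ H H' ≡ 2 →
    ∀ (r j s k : ℕ) → AdmissibleDeletionOrder H H' ((r , j) ∷ (s , k) ∷ []) →
    (∃[ q ] (s ≤ q × RequiredInsertionBase H H' q)) →
    (½ ≤ℚ βgeo H H') × (j ≡ 1 → βgeo H H' ≡ ½)
theorem6p1 H H' consecutive _ r j s k order insertion =
  ½≤/ (capacity H H') (d H) {{d-nonZero H}} lower ,
  λ { refl → /≡½ (capacity H H') (d H) {{d-nonZero H}} (≤-antisym lower (upper (All.head required))) }
  where
  open AdmissibleDeletionOrder order
  lower : d H ≤ 2 * capacity H H'
  lower = dH≤2*capacity order consecutive insertion
  capacity-pos : 0 < capacity H H'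
  capacity-pos = *-cancelˡ-< 2 0 (capacity H H') (<-≤-trans (>-nonZero⁻¹ (d H) {{d-nonZero H}}) lower)
  upper : RequiredDeletion H H' (r , 1) → 2 * capacity H H' ≤ d H
  -- A required layer at level 1 means that the exponent of `r` is at least 1 in `H` and below 1,
  -- hence 0, in `H'`.
  upper (pr , lo , hi) = 2*capacity≤dH {r} consecutive pr hi (n<1⇒n≡0 lo) capacity-pos
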